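{- Let $a,b$ be real numbers. For every integer $n\ge 3$, the bi-periodic Perrin sequence and the bi-periodic Padovan sequence satisfy $$R_n(a,b)=\begin{cases}3P_{n-3}(a,b)+2P_{n-2}(a,b), & \text{if } n \text{ is even},\\ 3P_{n-3}(b,a)+2P_{n-2}(b,a), & \text{if } n \text{ is odd}.\end{cases}$$
   Context: The bi-periodic Padovan sequence $\{P_n(a,b)\}_{n\ge 0}$ is defined by $P_0(a,b)=1$, $P_1(a,b)=0$, $P_2(a,b)=a$ and, for $n\ge 3$, $P_n(a,b)=aP_{n-2}(a,b)+P_{n-3}(a,b)$ if $n$ is even, $P_n(a,b)=bP_{n-2}(a,b)+P_{n-3}(a,b)$ if $n$ is odd. The bi-periodic Perrin sequence $\{R_n(a,b)\}_{n\ge 0}$ satisfies the same recurrence for $n\ge 3$ (coefficient $a$ for $n$ even, $b$ for $n$ odd), with initial values $R_0(a,b)=3$, $R_1(a,b)=0$, $R_2(a,b)=2$. The sequence $P_n(b,a)$ is obtained from $P_n(a,b)$ by interchanging the roles of $a$ and $b$ (in particular $P_2(b,a)=b$). -}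

module Defs where

open import Algebra.Bundles using (CommutativeRing)
open import Algebra.Structures using (IsCommutativeRing)
open import Data.Integer.Base using (+_)
open import Data.Nat.Base as ℕ using (ℕ; zero; suc; parity)
import Data.Nat.Properties as ℕ
open import Data.Parity.Base using (Parity; 0ℙ; 1ℙ)
open import Data.Product.Base using (Σ-syntax; ∃-syntax; _×_; _,_)
open import Data.Rational.Base as ℚ using (ℚ; 0ℚ; 1ℚ; ½; ∣_∣)
import Data.Rational.Properties as ℚ
open import Data.Rational.Solver using (module +-*-Solver)
open import Level using (0ℓ)
open import Relation.Binary.PropositionalEquality
  using (_≡_; refl; sym; trans; cong; subst)
open import Relation.Binary.Structures using (IsEquivalence)

-- The real numbers, as Cauchy sequences of rationals.  The library has no
-- quotients, so equality of reals is the relation _≈_ (the difference tends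
-- to 0) rather than _≡_.

Cauchy : (ℕ → ℚ) → Set
Cauchy x = ∀ ε → 0ℚ ℚ.< ε →
  ∃[ N ] (∀ m n → N ℕ.≤ m → N ℕ.≤ n → ∣ x m ℚ.- x n ∣ ℚ.< ε)

record ℝ : Set where
  no-eta-equality
  constructor mkℝ
  field
    seq    : ℕ → ℚ
    cauchy : Cauchy seq

open ℝ public

infix 4 _≈_

-- A record rather than a function, so that x and y can be inferred from x ≈ y.
record _≈_ (x y : ℝ) : Set where
  constructor mk≈
  field
    close : ∀ ε → 0ℚ ℚ.< ε →
      ∃[ N ] (∀ n → N ℕ.≤ n → ∣ seq x n ℚ.- seq y n ∣ ℚ.< ε)

open _≈_ public

private
  half-pos : ∀ {ε} → 0ℚ ℚ.< ε → 0ℚ ℚ.< ½ ℚ.* ε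
  half-pos {ε} 0<ε = subst (ℚ._< ½ ℚ.* ε) (ℚ.*-zeroʳ ½) (ℚ.*-monoʳ-<-pos ½ 0<ε)

  halves : ∀ ε → ½ ℚ.* ε ℚ.+ ½ ℚ.* ε ≡ ε
  halves ε = trans (sym (ℚ.*-distribʳ-+ ε ½ ½)) (ℚ.*-identityˡ ε)

  ∣+∣<ε : ∀ {ε} p q → ∣ p ∣ ℚ.< ½ ℚ.* ε → ∣ q ∣ ℚ.< ½ ℚ.* ε → ∣ p ℚ.+ q ∣ ℚ.< ε
  ∣+∣<ε {ε} p q p< q< = ℚ.≤-<-trans (ℚ.∣p+q∣≤∣p∣+∣q∣ p q)
    (subst (∣ p ∣ ℚ.+ ∣ q ∣ ℚ.<_) (halves ε) (ℚ.+-mono-< p< q<))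

  p≡q⇒∣p-q∣<ε : ∀ {ε p q} → 0ℚ ℚ.< ε → p ≡ q → ∣ p ℚ.- q ∣ ℚ.< ε
  p≡q⇒∣p-q∣<ε {ε} {p} 0<ε refl = subst (λ r → ∣ r ∣ ℚ.< ε) (sym (ℚ.+-inverseʳ p)) 0<ε

  ∣p-q∣≡∣q-p∣ : ∀ p q → ∣ p ℚ.- q ∣ ≡ ∣ q ℚ.- p ∣
  ∣p-q∣≡∣q-p∣ p q = trans (sym (ℚ.∣-p∣≡∣p∣ (p ℚ.- q))) (cong ∣_∣ (lemma p q))
    where
    open +-*-Solver
    lemma : ∀ p q → ℚ.- (p ℚ.- q) ≡ q ℚ.- p
    lemma = solve 2 (λ p q → :- (p :- q) := q :- p) refl

  -‿telescope : ∀ p q r → (p ℚ.- q) ℚ.+ (q ℚ.- r) ≡ p ℚ.- r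
  -‿telescope = solve 3 (λ p q r → (p :- q) :+ (q :- r) := p :- r) refl
    where open +-*-Solver

  +‿- : ∀ p q r s → (p ℚ.- r) ℚ.+ (q ℚ.- s) ≡ (p ℚ.+ q) ℚ.- (r ℚ.+ s)
  +‿- = solve 4 (λ p q r s → (p :- r) :+ (q :- s) := (p :+ q) :- (r :+ s)) refl
    where open +-*-Solver

  -‿- : ∀ p q → q ℚ.- p ≡ (ℚ.- p) ℚ.- (ℚ.- q)
  -‿- = solve 2 (λ p q → q :- p := (:- p) :- (:- q)) refl
    where open +-*-Solver

  -‿+ : ∀ p q → (p ℚ.- q) ℚ.+ q ≡ p
  -‿+ = solve 2 (λ p q → (p :- q) :+ q := p) refl
    where open +-*-Solver

  *‿- : ∀ p q r s → p ℚ.* (q ℚ.- s) ℚ.+ (p ℚ.- r) ℚ.* s ≡ p ℚ.* q ℚ.- r ℚ.* s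
  *‿- = solve 4 (λ p q r s → p :* (q :- s) :+ (p :- r) :* s := p :* q :- r :* s) refl
    where open +-*-Solver

  ∣p∣∣q∣<Bδ : ∀ {B δ} p q → 0ℚ ℚ.< B → ∣ p ∣ ℚ.< B → ∣ q ∣ ℚ.< δ → ∣ p ℚ.* q ∣ ℚ.< B ℚ.* δ
  ∣p∣∣q∣<Bδ {B} {δ} p q 0<B p<B q<δ = begin-strict
    ∣ p ℚ.* q ∣      ≡⟨ ℚ.∣p*q∣≡∣p∣*∣q∣ p q ⟩
    ∣ p ∣ ℚ.* ∣ q ∣  ≤⟨ ℚ.*-monoʳ-≤-nonNeg ∣ q ∣ {{ℚ.∣-∣-nonNeg q}} (ℚ.<⇒≤ p<B) ⟩
    B ℚ.* ∣ q ∣      <⟨ ℚ.*-monoʳ-<-pos B {{ℚ.positive 0<B}} q<δ ⟩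
    B ℚ.* δ          ∎
    where open ℚ.≤-Reasoning

  ∣pq-rs∣<ε : ∀ {B C δ ε} p q r s → 0ℚ ℚ.< B → 0ℚ ℚ.< C → (B ℚ.+ C) ℚ.* δ ≡ ε →
    ∣ p ∣ ℚ.< B → ∣ s ∣ ℚ.< C → ∣ p ℚ.- r ∣ ℚ.< δ → ∣ q ℚ.- s ∣ ℚ.< δ →
    ∣ p ℚ.* q ℚ.- r ℚ.* s ∣ ℚ.< ε
  ∣pq-rs∣<ε {B} {C} {δ} {ε} p q r s 0<B 0<C B+C p<B s<C p-r q-s = begin-strict
    ∣ p ℚ.* q ℚ.- r ℚ.* s ∣                      ≡⟨ cong ∣_∣ (sym (*‿- p q r s)) ⟩
    ∣ p ℚ.* (q ℚ.- s) ℚ.+ (p ℚ.- r) ℚ.* s ∣      ≤⟨ ℚ.∣p+q∣≤∣p∣+∣q∣ (p ℚ.* (q ℚ.- s)) ((p ℚ.- r) ℚ.* s) ⟩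
    ∣ p ℚ.* (q ℚ.- s) ∣ ℚ.+ ∣ (p ℚ.- r) ℚ.* s ∣  ≡⟨ cong (λ t → ∣ p ℚ.* (q ℚ.- s) ∣ ℚ.+ ∣ t ∣) (ℚ.*-comm (p ℚ.- r) s) ⟩
    ∣ p ℚ.* (q ℚ.- s) ∣ ℚ.+ ∣ s ℚ.* (p ℚ.- r) ∣  <⟨ ℚ.+-mono-< (∣p∣∣q∣<Bδ p (q ℚ.- s) 0<B p<B q-s) (∣p∣∣q∣<Bδ s (p ℚ.- r) 0<C s<C p-r) ⟩
    B ℚ.* δ ℚ.+ C ℚ.* δ                          ≡⟨ sym (ℚ.*-distribʳ-+ δ B C) ⟩
    (B ℚ.+ C) ℚ.* δ                              ≡⟨ B+C ⟩
    ε                                            ∎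
    where open ℚ.≤-Reasoning

  abstract
    scale : ∀ {D ε} r → ℚ.Positive r → D ℚ.* r ≡ 1ℚ →
      0ℚ ℚ.< ε → Σ[ δ ∈ ℚ ] (0ℚ ℚ.< δ × D ℚ.* δ ≡ ε)
    scale {D} {ε} r r-pos D*r≡1 0<ε = r ℚ.* ε
      , subst (ℚ._< r ℚ.* ε) (ℚ.*-zeroʳ r) (ℚ.*-monoʳ-<-pos r {{r-pos}} 0<ε)
      , trans (sym (ℚ.*-assoc D r ε)) (trans (cong (ℚ._* ε) D*r≡1) (ℚ.*-identityˡ ε))

    divide : ∀ {D ε} → 0ℚ ℚ.< D → 0ℚ ℚ.< ε → Σ[ δ ∈ ℚ ] (0ℚ ℚ.< δ × D ℚ.* δ ≡ ε)
    divide {D} 0<D = scale {D} ((ℚ.1/ D) {{D≢0}}) (ℚ.1/pos⇒pos D {{D-pos}}) (ℚ.*-inverseʳ D {{D≢0}})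
      where
      D-pos : ℚ.Positive D
      D-pos = ℚ.positive 0<D
      D≢0 : ℚ.NonZero D
      D≢0 = ℚ.pos⇒nonZero D {{D-pos}}

    ∣p∣<1+∣q∣ : ∀ p q → ∣ p ℚ.- q ∣ ℚ.< 1ℚ → ∣ p ∣ ℚ.< 1ℚ ℚ.+ ∣ q ∣
    ∣p∣<1+∣q∣ p q p-q<1 = begin-strict
      ∣ p ∣                    ≡⟨ cong ∣_∣ (sym (-‿+ p q)) ⟩
      ∣ (p ℚ.- q) ℚ.+ q ∣      ≤⟨ ℚ.∣p+q∣≤∣p∣+∣q∣ (p ℚ.- q) q ⟩
      ∣ p ℚ.- q ∣ ℚ.+ ∣ q ∣    <⟨ ℚ.+-monoˡ-< ∣ q ∣ p-q<1 ⟩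
      1ℚ ℚ.+ ∣ q ∣             ∎
      where open ℚ.≤-Reasoning

    0<1+∣q∣ : ∀ q → 0ℚ ℚ.< 1ℚ ℚ.+ ∣ q ∣
    0<1+∣q∣ q = ℚ.+-mono-<-≤ {0ℚ} {1ℚ} {0ℚ} {∣ q ∣} (ℚ.positive⁻¹ 1ℚ) (ℚ.0≤∣p∣ q)

    bounded : ∀ x → Σ[ B ∈ ℚ ] (0ℚ ℚ.< B × ∃[ N ] (∀ n → N ℕ.≤ n → ∣ seq x n ∣ ℚ.< B))
    bounded x = let N , c = cauchy x 1ℚ (ℚ.positive⁻¹ 1ℚ) in
      1ℚ ℚ.+ ∣ seq x N ∣ , 0<1+∣q∣ (seq x N) ,
      N , λ n N≤n → ∣p∣<1+∣q∣ (seq x n) (seq x N) (c n N N≤n ℕ.≤-refl)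

  module _ {M N k : ℕ} (le : M ℕ.⊔ N ℕ.≤ k) where
    ⊔ˡ : M ℕ.≤ k
    ⊔ˡ = ℕ.≤-trans (ℕ.m≤m⊔n M N) le
    ⊔ʳ : N ℕ.≤ k
    ⊔ʳ = ℕ.≤-trans (ℕ.m≤n⊔m M N) le

  abstract
    const-cauchy : ∀ q → Cauchy (λ _ → q)
    const-cauchy q ε 0<ε = 0 , λ _ _ _ _ → p≡q⇒∣p-q∣<ε {p = q} 0<ε refl

    +-cauchy : ∀ x y → Cauchy (λ n → seq x n ℚ.+ seq y n)
    +-cauchy x y ε 0<ε =
      let M , c = cauchy x (½ ℚ.* ε) (half-pos 0<ε)
          N , d = cauchy y (½ ℚ.* ε) (half-pos 0<ε)
      in M ℕ.⊔ N , λ m n ≤m ≤n →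
        subst (λ t → ∣ t ∣ ℚ.< ε) (+‿- (seq x m) (seq y m) (seq x n) (seq y n))
          (∣+∣<ε (seq x m ℚ.- seq x n) (seq y m ℚ.- seq y n)
            (c m n (⊔ˡ ≤m) (⊔ˡ ≤n)) (d m n (⊔ʳ {M} ≤m) (⊔ʳ {M} ≤n)))

    neg-cauchy : ∀ x → Cauchy (λ n → ℚ.- seq x n)
    neg-cauchy x ε 0<ε = let N , c = cauchy x ε 0<ε in
      N , λ m n ≤m ≤n →
        subst (λ t → ∣ t ∣ ℚ.< ε) (-‿- (seq x m) (seq x n)) (c n m ≤n ≤m)

    *-cauchy : ∀ x y → Cauchy (λ n → seq x n ℚ.* seq y n)
    *-cauchy x y ε 0<ε =
      let B , 0<B , K , b = bounded x
          C , 0<C , L , c = bounded y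
          δ , 0<δ , B+C = divide (ℚ.+-mono-< 0<B 0<C) 0<ε
          M , d = cauchy x δ 0<δ
          N , e = cauchy y δ 0<δ
      in (K ℕ.⊔ L) ℕ.⊔ (M ℕ.⊔ N) , λ m n ≤m ≤n →
        ∣pq-rs∣<ε (seq x m) (seq y m) (seq x n) (seq y n) 0<B 0<C B+C
          (b m (⊔ˡ (⊔ˡ ≤m))) (c n (⊔ʳ {K} (⊔ˡ ≤n)))
          (d m n (⊔ˡ (⊔ʳ {K ℕ.⊔ L} ≤m)) (⊔ˡ (⊔ʳ {K ℕ.⊔ L} ≤n)))
          (e m n (⊔ʳ {M} (⊔ʳ {K ℕ.⊔ L} ≤m)) (⊔ʳ {M} (⊔ʳ {K ℕ.⊔ L} ≤n)))

infixl 6 _+_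
infixl 7 _*_
infix  8 -_

_+_ : ℝ → ℝ → ℝ
x + y = mkℝ (λ n → seq x n ℚ.+ seq y n) (+-cauchy x y)

_*_ : ℝ → ℝ → ℝ
x * y = mkℝ (λ n → seq x n ℚ.* seq y n) (*-cauchy x y)

-_ : ℝ → ℝ
- x = mkℝ (λ n → ℚ.- seq x n) (neg-cauchy x)

fromℚ : ℚ → ℝ
fromℚ q = mkℝ (λ _ → q) (const-cauchy q)

fromℕ : ℕ → ℝ
fromℕ n = fromℚ (+ n ℚ./ 1)

private
  pointwise : ∀ {x y} → (∀ n → seq x n ≡ seq y n) → x ≈ y
  pointwise eq = mk≈ λ ε 0<ε → 0 , λ n _ → p≡q⇒∣p-q∣<ε 0<ε (eq n)

  ≈-sym : ∀ {x y} → x ≈ y → y ≈ x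
  ≈-sym {x} {y} (mk≈ f) = mk≈ λ ε 0<ε → let N , c = f ε 0<ε in
    N , λ n ≤n → subst (ℚ._< ε) (∣p-q∣≡∣q-p∣ (seq x n) (seq y n)) (c n ≤n)

  ≈-trans : ∀ {x y z} → x ≈ y → y ≈ z → x ≈ z
  ≈-trans {x} {y} {z} (mk≈ f) (mk≈ g) = mk≈ λ ε 0<ε →
    let M , c = f (½ ℚ.* ε) (half-pos 0<ε)
        N , d = g (½ ℚ.* ε) (half-pos 0<ε)
    in M ℕ.⊔ N , λ n ≤n →
      subst (λ t → ∣ t ∣ ℚ.< ε) (-‿telescope (seq x n) (seq y n) (seq z n))
        (∣+∣<ε (seq x n ℚ.- seq y n) (seq y n ℚ.- seq z n)
          (c n (⊔ˡ ≤n)) (d n (⊔ʳ {M} ≤n)))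

  ≈-isEquivalence : IsEquivalence _≈_
  ≈-isEquivalence = record
    { refl  = pointwise (λ _ → refl)
    ; sym   = ≈-sym
    ; trans = ≈-trans
    }

  +-cong : ∀ {x u y v} → x ≈ u → y ≈ v → x + y ≈ u + v
  +-cong {x} {u} {y} {v} (mk≈ f) (mk≈ g) = mk≈ λ ε 0<ε →
    let M , c = f (½ ℚ.* ε) (half-pos 0<ε)
        N , d = g (½ ℚ.* ε) (half-pos 0<ε)
    in M ℕ.⊔ N , λ n ≤n →
      subst (λ t → ∣ t ∣ ℚ.< ε) (+‿- (seq x n) (seq y n) (seq u n) (seq v n))
        (∣+∣<ε (seq x n ℚ.- seq u n) (seq y n ℚ.- seq v n)
          (c n (⊔ˡ ≤n)) (d n (⊔ʳ {M} ≤n)))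

  *-cong : ∀ {x u y v} → x ≈ u → y ≈ v → x * y ≈ u * v
  *-cong {x} {u} {y} {v} (mk≈ f) (mk≈ g) = mk≈ λ ε 0<ε →
    let B , 0<B , K , b = bounded x
        C , 0<C , L , c = bounded v
        δ , 0<δ , B+C = divide (ℚ.+-mono-< 0<B 0<C) 0<ε
        M , d = f δ 0<δ
        N , e = g δ 0<δ
    in (K ℕ.⊔ L) ℕ.⊔ (M ℕ.⊔ N) , λ n ≤n →
      ∣pq-rs∣<ε (seq x n) (seq y n) (seq u n) (seq v n) 0<B 0<C B+C
        (b n (⊔ˡ (⊔ˡ ≤n))) (c n (⊔ʳ {K} (⊔ˡ ≤n)))
        (d n (⊔ˡ (⊔ʳ {K ℕ.⊔ L} ≤n))) (e n (⊔ʳ {M} (⊔ʳ {K ℕ.⊔ L} ≤n)))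

  neg-cong : ∀ {x y} → x ≈ y → - x ≈ - y
  neg-cong {x} {y} x≈y = mk≈ λ ε 0<ε → let N , c = close (≈-sym x≈y) ε 0<ε in
    N , λ n ≤n → subst (λ t → ∣ t ∣ ℚ.< ε) (-‿- (seq x n) (seq y n)) (c n ≤n)

isCommutativeRing : IsCommutativeRing _≈_ _+_ _*_ -_ (fromℕ 0) (fromℕ 1)
isCommutativeRing = record
  { isRing = record
    { +-isAbelianGroup = record
      { isGroup = record
        { isMonoid = record
          { isSemigroup = record
            { isMagma = record { isEquivalence = ≈-isEquivalence ; ∙-cong = +-cong }
            ; assoc = λ x y z → pointwise λ n → ℚ.+-assoc (seq x n) (seq y n) (seq z n)
            }
          ; identity = (λ x → pointwise λ n → ℚ.+-identityˡ (seq x n))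
                     , (λ x → pointwise λ n → ℚ.+-identityʳ (seq x n))
          }
        ; inverse = (λ x → pointwise λ n → ℚ.+-inverseˡ (seq x n))
                  , (λ x → pointwise λ n → ℚ.+-inverseʳ (seq x n))
        ; ⁻¹-cong = neg-cong
        }
      ; comm = λ x y → pointwise λ n → ℚ.+-comm (seq x n) (seq y n)
      }
    ; *-cong = *-cong
    ; *-assoc = λ x y z → pointwise λ n → ℚ.*-assoc (seq x n) (seq y n) (seq z n)
    ; *-identity = (λ x → pointwise λ n → ℚ.*-identityˡ (seq x n))
                 , (λ x → pointwise λ n → ℚ.*-identityʳ (seq x n))
    ; distrib = (λ x y z → pointwise λ n → ℚ.*-distribˡ-+ (seq x n) (seq y n) (seq z n))
              , (λ x y z → pointwise λ n → ℚ.*-distribʳ-+ (seq x n) (seq y n) (seq z n))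
    }
  ; *-comm = λ x y → pointwise λ n → ℚ.*-comm (seq x n) (seq y n)
  }

ℝ-commutativeRing : CommutativeRing 0ℓ 0ℓ
ℝ-commutativeRing = record { isCommutativeRing = isCommutativeRing }

coefficient : ℝ → ℝ → Parity → ℝ
coefficient a b 0ℙ = a
coefficient a b 1ℙ = b

padovan : ℝ → ℝ → ℕ → ℝ
padovan a b 0 = fromℕ 1
padovan a b 1 = fromℕ 0
padovan a b 2 = a
padovan a b n@(suc (suc (suc k))) =
  coefficient a b (parity n) * padovan a b (suc k) + padovan a b k

perrin : ℝ → ℝ → ℕ → ℝ
perrin a b 0 = fromℕ 3
perrin a b 1 = fromℕ 0
perrin a b 2 = fromℕ 2
perrin a b n@(suc (suc (suc k))) =
  coefficient a b (parity n) * perrin a b (suc k) + perrin a b k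

{-# OPTIONS --safe #-}

-- Eliminating the even-indexed terms shows that the odd-indexed Padovan terms
-- satisfy P₆₊ₖ + ab P₂₊ₖ = (a + b) P₄₊ₖ + Pₖ, which is symmetric in a and b;
-- hence Pₖ(a,b) = Pₖ(b,a) for odd k.  This symmetry is what lets the even and
-- the odd case of the theorem feed each other in an induction on n.

module Submission where

open import Defs
open import Algebra.Bundles using (CommutativeRing)
open import Data.Nat.Base as ℕ using (ℕ; suc; _≤_; _∸_; parity; s≤s)
open import Data.Parity.Base using (0ℙ; 1ℙ; _⁻¹)
open import Data.Parity.Properties using (suc-homo-⁻¹)
open import Data.Product.Base using (_×_; _,_)
open import Relation.Binary.PropositionalEquality using (_≡_; cong; sym; trans)

open CommutativeRing ℝ-commutativeRing
  using (setoid; commutativeSemiring; +-group; +-cong; +-congʳ; +-congˡ; *-congˡ; reflexive)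
  renaming (refl to ≈-refl)
open import Algebra.Properties.Group +-group using (∙-cancelʳ)
open import Algebra.Solver.Ring.NaturalCoefficients.Default commutativeSemiring
open import Relation.Binary.Reasoning.Setoid setoid

parity-pred : ∀ {p} k → parity (suc k) ≡ p → parity k ≡ p ⁻¹
parity-pred k eq = trans (sym (suc-homo-⁻¹ k)) (cong _⁻¹ eq)

-- `parity` recurses in steps of two, so `parity (3 ℕ.+ k)` computes to `parity (suc k)` and is then
-- stuck for a variable `k`. Rewriting along the hypothesis turns the stuck coefficient into a
-- definite `a` or `b`.
padovan-step : ∀ {p} a b k → parity (suc k) ≡ p →
  padovan a b (3 ℕ.+ k) ≈ coefficient a b p * padovan a b (1 ℕ.+ k) + padovan a b k
padovan-step a b k eq = reflexive
  (cong (λ p → coefficient a b p * padovan a b (1 ℕ.+ k) + padovan a b k) eq)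

perrin-step : ∀ {p} a b k → parity (suc k) ≡ p →
  perrin a b (3 ℕ.+ k) ≈ coefficient a b p * perrin a b (1 ℕ.+ k) + perrin a b k
perrin-step a b k eq = reflexive
  (cong (λ p → coefficient a b p * perrin a b (1 ℕ.+ k) + perrin a b k) eq)

-- The term in `a * b` stands on the left to keep the identity free of subtraction, within reach of
-- a semiring solver.
padovan-odd-recurrence : ∀ a b k → parity k ≡ 1ℙ →
  padovan a b (6 ℕ.+ k) + a * b * padovan a b (2 ℕ.+ k) ≈
  (a + b) * padovan a b (4 ℕ.+ k) + padovan a b k
padovan-odd-recurrence a b k odd = begin
  P 6 + a * b * P 2                      ≈⟨ +-congʳ (padovan-step a b (3 ℕ.+ k) odd) ⟩
  b * P 4 + P 3 + a * b * P 2            ≈⟨ +-congʳ (+-congˡ (padovan-step a b k (parity-pred (suc k) odd))) ⟩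
  b * P 4 + (a * P 1 + P 0) + a * b * P 2
    ≈⟨ solve 6 (λ a b p₀ p₁ p₂ p₄ →
         b :* p₄ :+ (a :* p₁ :+ p₀) :+ a :* b :* p₂ :=
         a :* (b :* p₂ :+ p₁) :+ b :* p₄ :+ p₀) ≈-refl a b (P 0) (P 1) (P 2) (P 4) ⟩
  a * (b * P 2 + P 1) + b * P 4 + P 0    ≈⟨ +-congʳ (+-congʳ (*-congˡ (padovan-step a b (1 ℕ.+ k) odd))) ⟨
  a * P 4 + b * P 4 + P 0
    ≈⟨ solve 4 (λ a b p₀ p₄ → a :* p₄ :+ b :* p₄ :+ p₀ := (a :+ b) :* p₄ :+ p₀)
         ≈-refl a b (P 0) (P 4) ⟩
  (a + b) * P 4 + P 0                    ∎
  where
  P : ℕ → ℝ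
  P i = padovan a b (i ℕ.+ k)

padovan-odd-symmetric : ∀ a b k → parity k ≡ 1ℙ → padovan a b k ≈ padovan b a k
-- The recurrence links the offsets 0, 2, 4 and 6, so the induction needs three initial odd indices.
padovan-odd-symmetric a b 1 _ = ≈-refl
padovan-odd-symmetric a b 3 _ =
  solve 2 (λ a b → b :* con 0 :+ con 1 := a :* con 0 :+ con 1) ≈-refl a b
padovan-odd-symmetric a b 5 _ =
  solve 2 (λ a b → b :* (b :* con 0 :+ con 1) :+ a := a :* (a :* con 0 :+ con 1) :+ b)
    ≈-refl a b
padovan-odd-symmetric a b (suc (suc k+4@(suc (suc k+2@(suc (suc k)))))) odd =
  ∙-cancelʳ (a * b * P 2) (P 6) (Q 6) (begin
    P 6 + a * b * P 2      ≈⟨ padovan-odd-recurrence a b k odd ⟩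
    (a + b) * P 4 + P 0    ≈⟨ +-cong (*-congˡ (padovan-odd-symmetric a b k+4 odd))
                                     (padovan-odd-symmetric a b k odd) ⟩
    (a + b) * Q 4 + Q 0
      ≈⟨ solve 4 (λ a b q₀ q₄ → (a :+ b) :* q₄ :+ q₀ := (b :+ a) :* q₄ :+ q₀)
           ≈-refl a b (Q 0) (Q 4) ⟩
    (b + a) * Q 4 + Q 0    ≈⟨ padovan-odd-recurrence b a k odd ⟨
    Q 6 + b * a * Q 2
      ≈⟨ solve 4 (λ a b q₂ q₆ → q₆ :+ b :* a :* q₂ := q₆ :+ a :* b :* q₂)
           ≈-refl a b (Q 2) (Q 6) ⟩
    Q 6 + a * b * Q 2      ≈⟨ +-congˡ (*-congˡ (padovan-odd-symmetric a b k+2 odd)) ⟨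
    Q 6 + a * b * P 2      ∎)
  where
  P Q : ℕ → ℝ
  P i = padovan a b (i ℕ.+ k)
  Q i = padovan b a (i ℕ.+ k)

-- Even-indexed terms need not be symmetric in `a` and `b`, but both sides here expand the symmetric
-- odd-indexed term at `3 ℕ.+ k`: the left with the parameters interchanged, the right without.
padovan-even-swap : ∀ a b k → parity k ≡ 0ℙ →
  a * padovan a b (1 ℕ.+ k) + padovan b a k ≈ b * padovan a b (1 ℕ.+ k) + padovan a b k
padovan-even-swap a b k even = begin
  a * padovan a b (1 ℕ.+ k) + padovan b a k
    ≈⟨ +-congʳ (*-congˡ (padovan-odd-symmetric a b (1 ℕ.+ k) odd)) ⟩
  a * padovan b a (1 ℕ.+ k) + padovan b a k    ≈⟨ padovan-step b a k odd ⟨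
  padovan b a (3 ℕ.+ k)                        ≈⟨ padovan-odd-symmetric a b (3 ℕ.+ k) odd ⟨
  padovan a b (3 ℕ.+ k)                        ≈⟨ padovan-step a b k odd ⟩
  b * padovan a b (1 ℕ.+ k) + padovan a b k    ∎
  where
  odd : parity (suc k) ≡ 1ℙ
  odd = parity-pred (suc k) even

-- Mutual induction: the recurrence reaches back two and three places, hence to one index of the
-- same parity and one of the other. Indices 3, 4 and 5 are checked directly, since their
-- recurrences reach the initial values. The numbers 3 and 2 enter only as indeterminates `s` and
-- `t`.
perrin-even : ∀ a b k → parity (suc k) ≡ 0ℙ →
  perrin a b (3 ℕ.+ k) ≈ fromℕ 3 * padovan a b k + fromℕ 2 * padovan a b (1 ℕ.+ k)
perrin-odd : ∀ a b k → parity (suc k) ≡ 1ℙ →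
  perrin a b (3 ℕ.+ k) ≈ fromℕ 3 * padovan b a k + fromℕ 2 * padovan b a (1 ℕ.+ k)

perrin-even a b 1 _ =
  solve 3 (λ a s t → a :* t :+ con 0 := s :* con 0 :+ t :* a) ≈-refl a (fromℕ 3) (fromℕ 2)
perrin-even a b (suc (suc k+1@(suc k))) even = begin
  perrin a b (6 ℕ.+ k)    ≈⟨ perrin-step a b (3 ℕ.+ k) even ⟩
  a * perrin a b (4 ℕ.+ k) + perrin a b (3 ℕ.+ k)
    ≈⟨ +-cong (*-congˡ (perrin-even a b k+1 even)) (perrin-odd a b k odd) ⟩
  a * (s * P 1 + t * P 2) + (s * Q 0 + t * Q 1)
    ≈⟨ +-congˡ (+-congˡ (*-congˡ (padovan-odd-symmetric a b (1 ℕ.+ k) odd))) ⟨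
  a * (s * P 1 + t * P 2) + (s * Q 0 + t * P 1)
    ≈⟨ solve 6 (λ a s t p₁ p₂ q₀ →
         a :* (s :* p₁ :+ t :* p₂) :+ (s :* q₀ :+ t :* p₁) :=
         s :* (a :* p₁ :+ q₀) :+ t :* (a :* p₂ :+ p₁)) ≈-refl a s t (P 1) (P 2) (Q 0) ⟩
  s * (a * P 1 + Q 0) + t * (a * P 2 + P 1)
    -- `a * P 1 + Q 0` mixes both sequences and has the wrong coefficient for the odd index
    -- `3 ℕ.+ k`; the swap repairs both at once.
    ≈⟨ +-congʳ (*-congˡ (padovan-even-swap a b k even)) ⟩
  s * (b * P 1 + P 0) + t * (a * P 2 + P 1)
    ≈⟨ +-cong (*-congˡ (padovan-step a b k odd)) (*-congˡ (padovan-step a b (1 ℕ.+ k) even)) ⟨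
  s * P 3 + t * P 4       ∎
  where
  s t : ℝ
  s = fromℕ 3
  t = fromℕ 2
  P Q : ℕ → ℝ
  P i = padovan a b (i ℕ.+ k)
  Q i = padovan b a (i ℕ.+ k)
  odd : parity (suc k) ≡ 1ℙ
  odd = parity-pred (suc k) even

perrin-odd a b 0 _ =
  solve 3 (λ b s t → b :* con 0 :+ s := s :* con 1 :+ t :* con 0) ≈-refl b (fromℕ 3) (fromℕ 2)
perrin-odd a b 2 _ =
  solve 4 (λ a b s t → b :* (b :* con 0 :+ s) :+ t := s :* b :+ t :* (a :* con 0 :+ con 1))
    ≈-refl a b (fromℕ 3) (fromℕ 2)
perrin-odd a b (suc (suc k+1@(suc k))) odd = begin
  perrin a b (6 ℕ.+ k)    ≈⟨ perrin-step a b (3 ℕ.+ k) odd ⟩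
  b * perrin a b (4 ℕ.+ k) + perrin a b (3 ℕ.+ k)
    ≈⟨ +-cong (*-congˡ (perrin-odd a b k+1 odd)) (perrin-even a b k even) ⟩
  b * (s * Q 1 + t * Q 2) + (s * P 0 + t * P 1)
    ≈⟨ +-congˡ (+-congʳ (*-congˡ (padovan-odd-symmetric a b k odd))) ⟩
  b * (s * Q 1 + t * Q 2) + (s * Q 0 + t * P 1)
    ≈⟨ solve 7 (λ b s t q₀ q₁ q₂ p₁ →
         b :* (s :* q₁ :+ t :* q₂) :+ (s :* q₀ :+ t :* p₁) :=
         s :* (b :* q₁ :+ q₀) :+ t :* (b :* q₂ :+ p₁)) ≈-refl b s t (Q 0) (Q 1) (Q 2) (P 1) ⟩
  s * (b * Q 1 + Q 0) + t * (b * Q 2 + P 1)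
    -- Now `k` is odd, so the mixed sum is the one under `t`, and the swap applies at the even index
    -- `1 ℕ.+ k` with the parameters interchanged.
    ≈⟨ +-congˡ (*-congˡ (padovan-even-swap b a (1 ℕ.+ k) even)) ⟩
  s * (b * Q 1 + Q 0) + t * (a * Q 2 + Q 1)
    ≈⟨ +-cong (*-congˡ (padovan-step b a k even)) (*-congˡ (padovan-step b a (1 ℕ.+ k) odd)) ⟨
  s * Q 3 + t * Q 4       ∎
  where
  s t : ℝ
  s = fromℕ 3
  t = fromℕ 2
  P Q : ℕ → ℝ
  P i = padovan a b (i ℕ.+ k)
  Q i = padovan b a (i ℕ.+ k)
  even : parity (suc k) ≡ 0ℙ
  even = parity-pred (suc k) odd

proposition2 : ∀ (a b : ℝ) (n : ℕ) → 3 ≤ n →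
    (parity n ≡ 0ℙ →
    perrin a b n ≈ fromℕ 3 * padovan a b (n ∸ 3) + fromℕ 2 * padovan a b (n ∸ 2)) ×
    (parity n ≡ 1ℙ →
    perrin a b n ≈ fromℕ 3 * padovan b a (n ∸ 3) + fromℕ 2 * padovan b a (n ∸ 2))
proposition2 a b (suc (suc (suc k))) (s≤s (s≤s (s≤s _))) = perrin-even a b k , perrin-odd a b k
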